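{- For every $k\ge1$, $\mathrm{ABD}(k\text{ -CNF}^+)\le^{\mathrm{CV}}\mathrm{SimpleSAT}^k$. Moreover, the reduction maps an instance $(\mathrm{KB},H,M)$ to a $\mathrm{SimpleSAT}^k$ instance whose variables all belong to $H$.
   Context: $k\text{ -CNF}^+$ is the constraint language of positive clauses of arity $k$ (so $\Gamma$-formulas are conjunctions of clauses $(x_1\vee\dots\vee x_k)$ with not necessarily distinct variables). An instance of $\mathrm{ABD}(\Gamma)$ is $(\mathrm{KB},H,M)$, $\mathrm{KB}$ a $\Gamma$-formula, $H,M$ sets of variables; it asks whether there is $E\subseteq H\cup\{\neg x:x\in H\}$ with $\mathrm{KB}\wedge E$ satisfiable and $\mathrm{KB}\wedge E\models m$ for all $m\in M$. $\mathrm{SimpleSAT}^p$ is satisfiability of formulas $\bigwedge_i C_i\wedge\bigwedge_j(\bigvee_\ell T_{j,\ell})$, with each $C_i$ a clause of at most $p$ positive literals and each $T_{j,\ell}$ a conjunction of negative literals. For problems $A,B$ whose instances have variable sets, a CV-reduction $A\le^{\mathrm{CV}}B$ is a polynomial-time map $f$ such that $I$ is a yes-instance of $A$ iff $f(I)$ is a yes-instance of $B$ and $|\mathrm{var}(f(I))|\le|\mathrm{var}(I)|+O(1)$. -}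

module Defs where

open import Data.Bool using (Bool; true; false; _∧_; if_then_else_)
open import Data.Fin using (Fin; zero)
open import Data.List using (List; []; _∷_; _++_; map; concat; length; deduplicate)
open import Data.List.Membership.Propositional using (_∈_)
open import Data.List.Relation.Binary.Subset.Propositional using (_⊆_)
open import Data.List.Relation.Unary.All using (All)
open import Data.List.Relation.Unary.Any using (Any)
open import Data.Nat using (ℕ; suc; _+_; _*_; _^_; _≤_)
open import Data.Nat.Binary using (ℕᵇ; zero; 2[1+_]; 1+[2_]; fromℕ)
open import Data.Nat.Properties using (_≟_)
open import Data.Product using (Σ-syntax; ∃-syntax; _×_)
open import Data.Vec as Vec using (Vec; lookup; replicate; _[_]≔_)
open import Data.Vec.Bounded as Vec≤ using (Vec≤)
open import Function.Bundles using (_⇔_)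
open import Relation.Binary.PropositionalEquality using (_≡_; _≢_)

-- Model of computation: Jones' WHILE language over binary trees.
--
-- Reading a register is charged the size of the tree it holds: trees are
-- copied, never shared.  Hence the size of every computed value is bounded
-- by the time spent, and running time agrees with that of multi-tape
-- Turing machines up to a polynomial.

infixr 5 _·_

data Tree : Set where
  nil : Tree
  _·_ : Tree → Tree → Tree

size : Tree → ℕ
size nil     = 1
size (a · b) = suc (size a + size b)

head : Tree → Tree
head nil     = nil
head (a · _) = a

tail : Tree → Tree
tail nil     = nil
tail (_ · b) = b

equal : Tree → Tree → Bool
equal nil     nil     = true
equal nil     (_ · _) = false
equal (_ · _) nil     = false
equal (a · b) (c · d) = equal a c ∧ equal b d

-- nil is the only false value.
fromBool : Bool → Tree
fromBool b = if b then nil · nil else nil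

data Expr (n : ℕ) : Set where
  reg  : Fin n → Expr n
  nil  : Expr n
  cons : Expr n → Expr n → Expr n
  hd   : Expr n → Expr n
  tl   : Expr n → Expr n
  _=?_ : Expr n → Expr n → Expr n

Store : ℕ → Set
Store n = Vec Tree n

eval : ∀ {n} → Expr n → Store n → Tree
eval (reg x)    s = lookup s x
eval nil        s = nil
eval (cons e f) s = eval e s · eval f s
eval (hd e)     s = head (eval e s)
eval (tl e)     s = tail (eval e s)
eval (e =? f)   s = fromBool (equal (eval e s) (eval f s))

cost : ∀ {n} → Expr n → Store n → ℕ
cost (reg x)    s = size (lookup s x)
cost nil        s = 1
cost (cons e f) s = suc (cost e s + cost f s)
cost (hd e)     s = suc (cost e s)
cost (tl e)     s = suc (cost e s)
cost (e =? f)   s = suc (cost e s + cost f s)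

infix  6 _≔_
infixr 5 _⨾_

data Cmd (n : ℕ) : Set where
  skip  : Cmd n
  _≔_   : Fin n → Expr n → Cmd n
  _⨾_   : Cmd n → Cmd n → Cmd n
  cond  : Expr n → Cmd n → Cmd n → Cmd n
  while : Expr n → Cmd n → Cmd n

-- Exec c s t s′ : started in store s, command c halts in store s′ after
-- time t.
data Exec {n : ℕ} : Cmd n → Store n → ℕ → Store n → Set where
  skip : ∀ {s} → Exec skip s 1 s
  assign : ∀ {s x e} →
    Exec (x ≔ e) s (suc (cost e s)) (s [ x ]≔ eval e s)
  seq : ∀ {s s′ s″ c d t u} →
    Exec c s t s′ → Exec d s′ u s″ → Exec (c ⨾ d) s (t + u) s″
  cond-true : ∀ {s s′ e c d t} → eval e s ≢ nil →
    Exec c s t s′ → Exec (cond e c d) s (suc (cost e s + t)) s′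
  cond-false : ∀ {s s′ e c d t} → eval e s ≡ nil →
    Exec d s t s′ → Exec (cond e c d) s (suc (cost e s + t)) s′
  while-true : ∀ {s s′ s″ e c t u} → eval e s ≢ nil →
    Exec c s t s′ → Exec (while e c) s′ u s″ →
    Exec (while e c) s (suc (cost e s + (t + u))) s″
  while-false : ∀ {s e c} → eval e s ≡ nil →
    Exec (while e c) s (suc (cost e s)) s

-- Register 0 holds the input at the start and the output at the end; the
-- other registers are initially nil.
record Program : Set where
  field
    extra : ℕ
    body  : Cmd (suc extra)

Run : Program → Tree → ℕ → Tree → Set
Run p a t b =
  Σ[ s ∈ Store (suc extra) ]
    Exec body (a Vec.∷ replicate extra nil) t s × lookup s zero ≡ b
  where open Program p

PolyTime : {A B : Set} → (A → Tree) → (B → Tree) → (A → B) → Set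
PolyTime encA encB f =
  Σ[ p ∈ Program ] ∃[ c ] ∃[ d ] ∀ a → ∃[ t ]
    Run p (encA a) t (encB (f a)) × t ≤ c * size (encA a) ^ d + c

Var : Set
Var = ℕ

-- Number of distinct elements: lists of variables stand for finite sets.
card : List Var → ℕ
card xs = length (deduplicate _≟_ xs)

record Problem : Set₁ where
  field
    Instance : Set
    Yes      : Instance → Set
    vars     : Instance → List Var
    encode   : Instance → Tree

open Problem

record IsCVReduction (A B : Problem) (f : Instance A → Instance B) : Set where
  field
    polyTime : PolyTime (encode A) (encode B) f
    correct  : ∀ I → Yes A I ⇔ Yes B (f I)
    varBound : ∃[ c ] ∀ I → card (vars B (f I)) ≤ card (vars A I) + c

infix 4 _≤CV_

record _≤CV_ (A B : Problem) : Set where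
  field
    reduce        : Instance A → Instance B
    isCVReduction : IsCVReduction A B reduce

-- Variable names are written in (bijective) binary.
encBin : ℕᵇ → Tree
encBin zero     = nil
encBin 2[1+ b ] = nil · encBin b
encBin 1+[2 b ] = (nil · nil) · encBin b

encVar : Var → Tree
encVar x = encBin (fromℕ x)

encList : {A : Set} → (A → Tree) → List A → Tree
encList enc []       = nil
encList enc (x ∷ xs) = enc x · encList enc xs

Assignment : Set
Assignment = Var → Bool

data Literal : Set where
  pos neg : Var → Literal

SatLit : Assignment → Literal → Set
SatLit τ (pos x) = τ x ≡ true
SatLit τ (neg x) = τ x ≡ false

-- The clause x₁ ∨ … ∨ xₙ.
SatPosClause : Assignment → List Var → Set
SatPosClause τ xs = Any (λ x → SatLit τ (pos x)) xs

-- The term ¬x₁ ∧ … ∧ ¬xₙ.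
SatNegTerm : Assignment → List Var → Set
SatNegTerm τ xs = All (λ x → SatLit τ (neg x)) xs

CNF⁺ : ℕ → Set
CNF⁺ k = List (Vec Var k)

SatCNF⁺ : ∀ {k} → Assignment → CNF⁺ k → Set
SatCNF⁺ τ φ = All (λ c → SatPosClause τ (Vec.toList c)) φ

record AbdInstance (k : ℕ) : Set where
  field
    KB : CNF⁺ k
    H  : List Var
    M  : List Var

module _ {k : ℕ} (I : AbdInstance k) where
  open AbdInstance I

  SatKB∧ : List Literal → Assignment → Set
  SatKB∧ E τ = SatCNF⁺ τ KB × All (SatLit τ) E

  IsExplanation : List Literal → Set
  IsExplanation E =
    E ⊆ map pos H ++ map neg H ×
    (∃[ τ ] SatKB∧ E τ) ×
    (∀ m → m ∈ M → ∀ τ → SatKB∧ E τ → SatLit τ (pos m))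

  abdVars : List Var
  abdVars = concat (map Vec.toList KB) ++ H ++ M

  encAbd : Tree
  encAbd =
    encList (λ c → encList encVar (Vec.toList c)) KB ·
    encList encVar H ·
    encList encVar M

ABD-CNF⁺ : ℕ → Problem
ABD-CNF⁺ k = record
  { Instance = AbdInstance k
  ; Yes      = λ I → ∃[ E ] IsExplanation I E
  ; vars     = abdVars
  ; encode   = encAbd
  }

-- clauses lists the Cᵢ, each by its variables; disjunctions lists the
-- ⋁ₗ Tⱼₗ, each Tⱼₗ being given by the variables it negates.
record SimpleInstance (p : ℕ) : Set where
  field
    clauses      : List (Vec≤ Var p)
    disjunctions : List (List (List Var))

module _ {p : ℕ} (I : SimpleInstance p) where
  open SimpleInstance I

  SatSimple : Assignment → Set
  SatSimple τ =
    All (λ c → SatPosClause τ (Vec≤.toList c)) clauses ×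
    All (Any (SatNegTerm τ)) disjunctions

  simpleVars : List Var
  simpleVars = concat (map Vec≤.toList clauses) ++ concat (concat disjunctions)

  encSimple : Tree
  encSimple =
    encList (λ c → encList encVar (Vec≤.toList c)) clauses ·
    encList (encList (encList encVar)) disjunctions

SimpleSAT : ℕ → Problem
SimpleSAT p = record
  { Instance = SimpleInstance p
  ; Yes      = λ I → ∃[ τ ] SatSimple I τ
  ; vars     = simpleVars
  ; encode   = encSimple
  }

{-# OPTIONS --safe #-}
module Submission where

-- Let τ be an assignment of H.  As KB is positive, it is consistent with τ iff
-- τ satisfies the clauses of KB inside H: all other variables may be set to
-- true.  A manifestation m ∈ H is entailed iff τ makes it true, and m ∉ H is
-- entailed iff some clause C ∋ m has all of C ∖ {m} inside H and false under τ:
-- otherwise m may be set to false and all other variables outside H to true.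
-- So the instance consists of the clauses inside H, a unit clause for each
-- m ∈ M ∩ H, and for each m ∈ M ∖ H the disjunction of the negative terms
-- given by such C ∖ {m}.
--
-- Polynomial time is obtained from a general criterion: a program whose loops
-- run along subtrees of the input, and whose registers accumulate only values
-- of registers of lower level, keeps all values polynomially small.

open import Defs
open import Data.Bool using (Bool; true; false; if_then_else_; _∧_; _∨_; not)
import Data.Bool.Properties as Bool
open import Data.Empty using (⊥)
open import Data.Fin using (Fin; zero; suc; #_)
import Data.Fin.Properties as Fin
open import Data.List using (List; []; _∷_; [_]; _++_; map; filter; take; length; reverse; concat; _ʳ++_)
open import Data.List.Properties using (length-++)
open import Data.List.Membership.Propositional using (_∈_; lose; find)
open import Data.List.Membership.Propositional.Properties using (∈-∃++; ∈-++⁺ˡ; ∈-++⁺ʳ; ∈-++⁻; ∈-map⁺; ∈-map⁻; ∈-filter⁺; ∈-filter⁻; ∈-concat⁻′; ∈-deduplicate⁺; ∈-deduplicate⁻)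
import Data.List.Membership.DecPropositional as DecMembership
open import Data.List.Relation.Binary.Subset.Propositional using (_⊆_)
open import Data.List.Relation.Unary.All as All using (All)
open import Data.List.Relation.Unary.All.Properties using (¬All⇒Any¬; map⁺)
open import Data.List.Relation.Unary.Any as Any using (Any; here; there)
import Data.List.Relation.Unary.Any.Properties as Any
open import Data.List.Relation.Unary.AllPairs using ([]; _∷_)
open import Data.List.Relation.Unary.Unique.Propositional using (Unique)
open import Data.List.Relation.Unary.Unique.DecPropositional.Properties using (deduplicate-!)
open import Data.Nat using (ℕ; zero; suc; _+_; _*_; _^_; _≤_; z≤n; s≤s; NonZero; _≤?_; _≤′_; ≤′-refl; ≤′-step)
open import Data.Nat.Binary using (zero; 2[1+_]; 1+[2_])
import Data.Nat.Binary.Properties as ℕᵇ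
open import Data.Nat.Properties
open import Data.Product using (Σ-syntax; ∃-syntax; _×_; _,_)
open import Data.Sum using (_⊎_; inj₁; inj₂)
open import Data.Unit using (⊤; tt)
open import Data.Vec as Vec using (Vec; []; _∷_; lookup; replicate; _[_]≔_)
open import Data.Vec.Bounded as Vec≤ using (Vec≤)
open import Data.Vec.Properties using (lookup∘updateAt; lookup∘updateAt′; lookup-replicate)
open import Function using (_∘_; case_of_)
open import Function.Bundles using (mk⇔)
open import Relation.Nullary using (¬_; Dec; does; yes; no; ¬?; _×-dec_; from-yes; contradiction)
open import Relation.Nullary.Decidable using (dec-true; dec-false; decidable-stable)
open import Relation.Binary.PropositionalEquality using (_≡_; _≢_; refl; sym; trans; cong; cong₂; subst; module ≡-Reasoning)

open DecMembership _≟_ using (_∈?_)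

-- Polynomially bounded functions

PolyBounded : (ℕ → ℕ) → Set
PolyBounded f = ∃[ c ] ∃[ d ] ∀ n → .{{NonZero n}} → f n ≤ c * n ^ d

poly-const : ∀ c → PolyBounded (λ _ → c)
poly-const c = c , 0 , λ _ → ≤-reflexive (sym (*-identityʳ c))

poly-id : PolyBounded (λ n → n)
poly-id = 1 , 1 , λ n → ≤-reflexive (sym (trans (*-identityˡ (n ^ 1)) (*-identityʳ n)))

poly-+ : ∀ {f g} → PolyBounded f → PolyBounded g → PolyBounded (λ n → f n + g n)
poly-+ {f} {g} (c , d , f≤) (c′ , d′ , g≤) = c + c′ , d + d′ , λ n → begin
  f n + g n                              ≤⟨ +-mono-≤ (f≤ n) (g≤ n) ⟩
  -- Raising both exponents to `d + d′` needs `n` nonzero, hence the instance argument in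
  -- `PolyBounded`.
  c * n ^ d + c′ * n ^ d′                ≤⟨ +-mono-≤ (*-monoʳ-≤ c (^-monoʳ-≤ n (m≤m+n d d′)))
                                                     (*-monoʳ-≤ c′ (^-monoʳ-≤ n (m≤n+m d′ d))) ⟩
  c * n ^ (d + d′) + c′ * n ^ (d + d′)   ≡⟨ *-distribʳ-+ (n ^ (d + d′)) c c′ ⟨
  (c + c′) * n ^ (d + d′)                ∎
  where open ≤-Reasoning

poly-* : ∀ {f g} → PolyBounded f → PolyBounded g → PolyBounded (λ n → f n * g n)
poly-* {f} {g} (c , d , f≤) (c′ , d′ , g≤) = c * c′ , d + d′ , λ n → begin
  f n * g n                    ≤⟨ *-mono-≤ (f≤ n) (g≤ n) ⟩
  c * n ^ d * (c′ * n ^ d′)    ≡⟨ [m*n]*[o*p]≡[m*o]*[n*p] c (n ^ d) c′ (n ^ d′) ⟩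
  c * c′ * (n ^ d * n ^ d′)    ≡⟨ cong (c * c′ *_) (^-distribˡ-+-* n d d′) ⟨
  c * c′ * n ^ (d + d′)        ∎
  where open ≤-Reasoning

poly-suc : ∀ {f} → PolyBounded f → PolyBounded (λ n → suc (f n))
poly-suc = poly-+ (poly-const 1)

-- Structured programs

infix  6 _⊲_
infixr 5 _then_

-- x ⊲ e overwrites x; push x e conses e onto x; for x p runs p once for each
-- element of the list in x, x being the remaining list during each run and
-- nil afterwards.
data Prog (n : ℕ) : Set where
  skip   : Prog n
  _⊲_    : Fin n → Expr n → Prog n
  push   : Fin n → Expr n → Prog n
  _then_ : Prog n → Prog n → Prog n
  cond   : Expr n → Prog n → Prog n → Prog n
  for    : Fin n → Prog n → Prog n

compile : ∀ {n} → Prog n → Cmd n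
compile skip         = skip
compile (x ⊲ e)      = x ≔ e
compile (push x e)   = x ≔ cons e (reg x)
compile (p then q)   = compile p ⨾ compile q
compile (cond e p q) = cond e (compile p) (compile q)
compile (for x p)    = while (reg x) (compile p ⨾ x ≔ tl (reg x))

branch : {A : Set} → Tree → A → A → A
branch nil     a b = b
branch (_ · _) a b = a

-- Recursion is on the value of the loop register at entry, so `run` is total. The compiled loop
-- takes the tail of the current value instead; the two agree when the body does not write `x`,
-- hence `Unwritten` in `Levelled`.
iterate : ∀ {n} → Fin n → (Store n → Store n) → Tree → Store n → Store n
iterate x f nil     s = s
iterate x f (_ · v) s = iterate x f v (f s [ x ]≔ v)

run : ∀ {n} → Prog n → Store n → Store n
run skip         s = s
run (x ⊲ e)      s = s [ x ]≔ eval e s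
run (push x e)   s = s [ x ]≔ eval (cons e (reg x)) s
run (p then q)   s = run q (run p s)
run (cond e p q) s = branch (eval e s) (run p s) (run q s)
run (for x p)    s = iterate x (run p) (lookup s x) s

Unwritten : ∀ {n} → Fin n → Prog n → Set
Unwritten x skip         = ⊤
Unwritten x (y ⊲ _)      = x ≢ y
Unwritten x (push y _)   = x ≢ y
Unwritten x (p then q)   = Unwritten x p × Unwritten x q
Unwritten x (cond _ p q) = Unwritten x p × Unwritten x q
Unwritten x (for y p)    = x ≢ y × Unwritten x p

unwritten? : ∀ {n} (x : Fin n) p → Dec (Unwritten x p)
unwritten? x skip         = yes tt
unwritten? x (y ⊲ _)      = ¬? (x Fin.≟ y)
unwritten? x (push y _)   = ¬? (x Fin.≟ y)
unwritten? x (p then q)   = unwritten? x p ×-dec unwritten? x q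
unwritten? x (cond _ p q) = unwritten? x p ×-dec unwritten? x q
unwritten? x (for y p)    = ¬? (x Fin.≟ y) ×-dec unwritten? x p

lookup-run : ∀ {n} {x : Fin n} p s → Unwritten x p → lookup (run p s) x ≡ lookup s x
lookup-iterate : ∀ {n} {x y : Fin n} p v s → x ≢ y → Unwritten x p →
  lookup (iterate y (run p) v s) x ≡ lookup s x

lookup-run skip         s _   = refl
lookup-run (y ⊲ _)      s x≢y = lookup∘updateAt′ _ y x≢y s
lookup-run (push y _)   s x≢y = lookup∘updateAt′ _ y x≢y s
lookup-run (p then q)   s (u , u′) = trans (lookup-run q (run p s) u′) (lookup-run p s u)
lookup-run (cond e p q) s (u , u′) with eval e s
... | nil   = lookup-run q s u′
... | _ · _ = lookup-run p s u
lookup-run (for y p)    s (x≢y , u) = lookup-iterate p (lookup s y) s x≢y u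

lookup-iterate p nil     s x≢y u = refl
lookup-iterate {y = y} p (_ · v) s x≢y u = trans
  (lookup-iterate p v (run p s [ y ]≔ v) x≢y u)
  (trans (lookup∘updateAt′ _ y x≢y (run p s)) (lookup-run p s u))

-- Every register x has a level.  A register of level 0 only ever holds a
-- subtree of the input, so a for-loop over it makes at most linearly many
-- rounds; a register of a higher level may in addition accumulate values of
-- strictly lower level.  This excludes the exponential growth of x ≔ cons x x.
module _ {n : ℕ} (level : Fin n → ℕ) where

  -- Such an expression reads off a subtree of one register, or `nil`, so larger trees arise by
  -- `push` alone and growth can be counted. Tests of `cond` are left free because their values are
  -- never stored.
  Within : ℕ → Expr n → Set
  Within l (reg x)    = level x ≤ l
  Within l nil        = ⊤
  Within l (cons _ _) = ⊥
  Within l (hd e)     = Within l e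
  Within l (tl e)     = Within l e
  Within l (_ =? _)   = ⊥

  Below : ℕ → Expr n → Set
  Below zero    e = ⊥
  Below (suc l) e = Within l e

  Levelled : Prog n → Set
  Levelled skip         = ⊤
  Levelled (x ⊲ e)      = Within (level x) e
  Levelled (push x e)   = Below (level x) e
  Levelled (p then q)   = Levelled p × Levelled q
  Levelled (cond _ p q) = Levelled p × Levelled q
  Levelled (for x p)    = level x ≡ 0 × Unwritten x p × Levelled p

  within? : ∀ l e → Dec (Within l e)
  within? l (reg x)    = level x ≤? l
  within? l nil        = yes tt
  within? l (cons _ _) = no λ ()
  within? l (hd e)     = within? l e
  within? l (tl e)     = within? l e
  within? l (_ =? _)   = no λ ()

  below? : ∀ l e → Dec (Below l e)
  below? zero    e = no λ ()
  below? (suc l) e = within? l e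

  levelled? : ∀ p → Dec (Levelled p)
  levelled? skip         = yes tt
  levelled? (x ⊲ e)      = within? (level x) e
  levelled? (push x e)   = below? (level x) e
  levelled? (p then q)   = levelled? p ×-dec levelled? q
  levelled? (cond _ p q) = levelled? p ×-dec levelled? q
  levelled? (for x p)    = (level x ≟ 0) ×-dec unwritten? x p ×-dec levelled? p

-- Bounds on pushes, time and size

exprSize : ∀ {n} → Expr n → ℕ
exprSize (reg _)    = 1
exprSize nil        = 1
exprSize (cons e f) = suc (exprSize e + exprSize f)
exprSize (hd e)     = suc (exprSize e)
exprSize (tl e)     = suc (exprSize e)
exprSize (e =? f)   = suc (exprSize e + exprSize f)

-- Bound on the number of pushes when the input has size N.
pushes : ∀ {n} → Prog n → ℕ → ℕ
pushes skip         N = 0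
pushes (_ ⊲ _)      N = 0
pushes (push _ _)   N = 1
pushes (p then q)   N = pushes p N + pushes q N
pushes (cond _ p q) N = pushes p N + pushes q N
pushes (for _ p)    N = N * pushes p N

-- Bound on the running time when moreover all registers have size at most G.
time : ∀ {n} → Prog n → ℕ → ℕ → ℕ
roundTime : ∀ {n} → Prog n → ℕ → ℕ → ℕ

time skip         N G = 1
time (_ ⊲ e)      N G = suc (exprSize e * G)
time (push x e)   N G = suc (exprSize (cons e (reg x)) * G)
time (p then q)   N G = time p N G + time q N G
-- The sum of the branches stands in for their maximum and keeps the bound within closure under sums
-- and products.
time (cond e p q) N G = suc (exprSize e * G + (time p N G + time q N G))
time (for _ p)    N G = N * roundTime p N G + suc G

-- The summands pay for the test, the body, and the assignment of the tail; the `suc G` in `time`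
-- pays for the last, failing test.
roundTime p N G = suc (G + (time p N G + suc (suc G)))

-- Bound on a register of level l after t of at most T pushes.
sizeBound : (N T l t : ℕ) → ℕ
sizeBound N T zero    t = N
-- Each push adds one node and a value of level at most `l`.
sizeBound N T (suc l) t = sizeBound N T l T + t * suc (sizeBound N T l T)

poly-pushes : ∀ {n} (p : Prog n) → PolyBounded (pushes p)
poly-pushes skip         = poly-const 0
poly-pushes (_ ⊲ _)      = poly-const 0
poly-pushes (push _ _)   = poly-const 1
poly-pushes (p then q)   = poly-+ (poly-pushes p) (poly-pushes q)
poly-pushes (cond _ p q) = poly-+ (poly-pushes p) (poly-pushes q)
poly-pushes (for _ p)    = poly-* poly-id (poly-pushes p)

-- Each level multiplies the bound by about `T`, so for a fixed level the degree is fixed.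
poly-sizeBound : ∀ {T} l → PolyBounded T → PolyBounded (λ N → sizeBound N (T N) l (T N))
poly-sizeBound zero    pT = poly-id
poly-sizeBound (suc l) pT =
  poly-+ (poly-sizeBound l pT) (poly-* pT (poly-suc (poly-sizeBound l pT)))

poly-time : ∀ {n G} (p : Prog n) → PolyBounded G → PolyBounded (λ N → time p N (G N))
poly-time skip         pG = poly-const 1
poly-time (_ ⊲ e)      pG = poly-suc (poly-* (poly-const (exprSize e)) pG)
poly-time (push x e)   pG = poly-suc (poly-* (poly-const (exprSize (cons e (reg x)))) pG)
poly-time (p then q)   pG = poly-+ (poly-time p pG) (poly-time q pG)
poly-time (cond e p q) pG = poly-suc
  (poly-+ (poly-* (poly-const (exprSize e)) pG) (poly-+ (poly-time p pG) (poly-time q pG)))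
poly-time (for _ p)    pG = poly-+
  (poly-* poly-id (poly-suc (poly-+ pG (poly-+ (poly-time p pG) (poly-suc (poly-suc pG))))))
  (poly-suc pG)

size>0 : ∀ t → 1 ≤ size t
size>0 nil     = s≤s z≤n
size>0 (_ · _) = s≤s z≤n

size-head : ∀ t → size (head t) ≤ size t
size-head nil     = ≤-refl
size-head (a · b) = m≤n⇒m≤1+n (m≤m+n (size a) (size b))

size-tail : ∀ t → size (tail t) ≤ size t
size-tail nil     = ≤-refl
size-tail (a · b) = m≤n⇒m≤1+n (m≤n+m (size b) (size a))

module _ {n G : ℕ} (s : Store n) (1≤G : 1 ≤ G) (small : ∀ x → size (lookup s x) ≤ G) where

  cost-bound : ∀ e → cost e s ≤ exprSize e * G
  cost-bound₂ : ∀ e f → suc (cost e s + cost f s) ≤ suc (exprSize e + exprSize f) * G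

  cost-bound (reg x)    = ≤-trans (small x) (≤-reflexive (sym (*-identityˡ G)))
  cost-bound nil        = ≤-trans 1≤G (≤-reflexive (sym (*-identityˡ G)))
  cost-bound (cons e f) = cost-bound₂ e f
  cost-bound (hd e)     = +-mono-≤ 1≤G (cost-bound e)
  cost-bound (tl e)     = +-mono-≤ 1≤G (cost-bound e)
  cost-bound (e =? f)   = cost-bound₂ e f

  cost-bound₂ e f = +-mono-≤ 1≤G (≤-trans (+-mono-≤ (cost-bound e) (cost-bound f))
    (≤-reflexive (sym (*-distribʳ-+ G (exprSize e) (exprSize f)))))

module _ {N T : ℕ} where

  sizeBound-monoᵗ : ∀ l {t u} → t ≤ u → sizeBound N T l t ≤ sizeBound N T l u
  sizeBound-monoᵗ zero    t≤u = ≤-refl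
  sizeBound-monoᵗ (suc l) t≤u = +-monoʳ-≤ _ (*-monoˡ-≤ _ t≤u)

  -- The bound for `suc l` starts from the bound for `l` after all `T` pushes, so it dominates the
  -- latter at every `t ≤ T`.
  sizeBound-monoˡ : ∀ {l l′ t} → t ≤ T → l ≤ l′ → sizeBound N T l t ≤ sizeBound N T l′ t
  sizeBound-monoˡ {t = t} t≤T l≤l′ = go (≤⇒≤′ l≤l′)
    where
    go : ∀ {l l′} → l ≤′ l′ → sizeBound N T l t ≤ sizeBound N T l′ t
    go ≤′-refl          = ≤-refl
    go (≤′-step {n} le) = ≤-trans (go le) (≤-trans (sizeBound-monoᵗ n t≤T) (m≤m+n _ _))

  N≤sizeBound : ∀ l t → N ≤ sizeBound N T l t
  N≤sizeBound zero    t = ≤-refl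
  N≤sizeBound (suc l) t = ≤-trans (N≤sizeBound l T) (m≤m+n _ _)

size-update : ∀ {n} {b : Fin n → ℕ} (s : Store n) x {v} → (∀ y → size (lookup s y) ≤ b y) →
  size v ≤ b x → ∀ y → size (lookup (s [ x ]≔ v) y) ≤ b y
size-update s x {v} small v≤ y with y Fin.≟ x
... | yes refl rewrite lookup∘updateAt y {f = λ _ → v} s       = v≤
... | no  y≢x  rewrite lookup∘updateAt′ y x {f = λ _ → v} y≢x s = small y

-- Execution of levelled programs

module _ {n : ℕ} (level : Fin n → ℕ) (L : ℕ) (level≤L : ∀ x → level x ≤ L)
         (N T : ℕ) (1≤N : 1 ≤ N) where

  G : ℕ
  G = sizeBound N T L T

  record Bounded (t : ℕ) (s : Store n) : Set where
    constructor bounded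
    field register≤ : ∀ x → size (lookup s x) ≤ sizeBound N T (level x) t

  open Bounded

  weaken : ∀ {t u s} → t ≤ u → Bounded t s → Bounded u s
  weaken t≤u b = bounded λ x → ≤-trans (register≤ b x) (sizeBound-monoᵗ (level x) t≤u)

  1≤G : 1 ≤ G
  1≤G = ≤-trans 1≤N (N≤sizeBound L T)

  register≤G : ∀ {t s} → t ≤ T → Bounded t s → ∀ x → size (lookup s x) ≤ G
  register≤G t≤T b x = ≤-trans (register≤ (weaken t≤T b) x) (sizeBound-monoˡ ≤-refl (level≤L x))

  size-within : ∀ {t l s} e → t ≤ T → Bounded t s → Within level l e →
    size (eval e s) ≤ sizeBound N T l t
  size-within (reg x) t≤T b w = ≤-trans (register≤ b x) (sizeBound-monoˡ t≤T w)
  size-within {t} {l} nil t≤T b w = ≤-trans 1≤N (N≤sizeBound l t)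
  size-within {s = s} (hd e) t≤T b w = ≤-trans (size-head (eval e s)) (size-within e t≤T b w)
  size-within {s = s} (tl e) t≤T b w = ≤-trans (size-tail (eval e s)) (size-within e t≤T b w)

  -- The pushed value has lower level, so the increment is at most the fixed amount `suc B`: growth
  -- is additive, not multiplicative.
  size-push : ∀ {l t a b} → t ≤ T → size a ≤ sizeBound N T l t →
    size b ≤ sizeBound N T (suc l) t → size (a · b) ≤ sizeBound N T (suc l) (suc t)
  size-push {l} {t} {a} {b} t≤T a≤ b≤ = begin
    suc (size a + size b)             ≤⟨ +-mono-≤ (s≤s (≤-trans a≤ (sizeBound-monoᵗ l t≤T))) b≤ ⟩
    suc B + (B + t * suc B)           ≡⟨ +-assoc (suc B) B (t * suc B) ⟨
    suc B + B + t * suc B             ≡⟨ cong (_+ t * suc B) (+-comm (suc B) B) ⟩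
    B + suc B + t * suc B             ≡⟨ +-assoc B (suc B) (t * suc B) ⟩
    B + suc t * suc B                 ∎
    where
    open ≤-Reasoning
    B = sizeBound N T l T

  cost≤ : ∀ {t s} e → t ≤ T → Bounded t s → cost e s ≤ exprSize e * G
  cost≤ {s = s} e t≤T b = cost-bound s 1≤G (register≤G t≤T b) e

  Halts : ℕ → Prog n → Store n → Set
  Halts t p s =
    (∃[ u ] Exec (compile p) s u (run p s) × u ≤ time p N G) × Bounded (t + pushes p N) (run p s)

  -- Time and size go through one induction: the time bound relies on registers staying below `G`,
  -- and the size bound on loops making at most `N` rounds.
  halts : ∀ p {s t} → Levelled level p → t + pushes p N ≤ T → Bounded t s → Halts t p s
  -- The budget `k` bounds the size of the loop value, hence the number of remaining rounds; passing
  -- to the tail lowers it by one.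
  halts-for : ∀ x p v {s t} k → level x ≡ 0 → Unwritten x p → Levelled level p →
    lookup s x ≡ v → size v ≤ k → k ≤ N → t + k * pushes p N ≤ T → Bounded t s →
    (∃[ u ] Exec (compile (for x p)) s u (iterate x (run p) v s) ×
            u ≤ k * roundTime p N G + suc G) ×
    Bounded (t + k * pushes p N) (iterate x (run p) v s)

  halts skip wf t≤T b = (_ , skip , ≤-refl) , weaken (m≤m+n _ 0) b
  halts (x ⊲ e) {s} {t} wf t≤T b =
    (_ , assign , s≤s (cost≤ e t≤T′ b)) ,
    weaken (m≤m+n t 0) (bounded (size-update s x (register≤ b) (size-within e t≤T′ b wf)))
    where t≤T′ = ≤-trans (m≤m+n t 0) t≤T
  halts (push x e) {s} {t} wf t≤T b =
    (_ , assign , s≤s (cost≤ (cons e (reg x)) t≤T′ b)) ,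
    weaken (≤-reflexive (+-comm 1 t)) (bounded (size-update s x
      (register≤ (weaken (n≤1+n t) b)) (fits (level x) wf (register≤ b x))))
    where
    t≤T′ = ≤-trans (m≤m+n t 1) t≤T
    -- Abstracting the level lets the match discard level zero, where `Below` is empty.
    fits : ∀ l → Below level l e → size (lookup s x) ≤ sizeBound N T l t →
      size (eval e s · lookup s x) ≤ sizeBound N T l (suc t)
    fits (suc l) w = size-push {l} t≤T′ (size-within e t≤T′ b w)
  halts (p then q) {s} {t} (wp , wq) t≤T b
    with t+p+q≤T ← ≤-trans (≤-reflexive (+-assoc t (pushes p N) (pushes q N))) t≤T
    with (u , ep , u≤) , bp ← halts p wp (≤-trans (m≤m+n _ (pushes q N)) t+p+q≤T) b
    with (u′ , eq , u′≤) , bq ← halts q wq t+p+q≤T bp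
    = (_ , seq ep eq , +-mono-≤ u≤ u′≤) ,
      weaken (≤-reflexive (+-assoc t (pushes p N) (pushes q N))) bq
  halts (cond e p q) {s} {t} (wp , wq) t≤T b
    with eval e s in eq
  ... | nil
    with (u , ex , u≤) , bq ← halts q wq (≤-trans (+-monoʳ-≤ t (m≤n+m _ (pushes p N))) t≤T) b
    = (_ , cond-false eq ex ,
        s≤s (+-mono-≤ (cost≤ e (≤-trans (m≤m+n t _) t≤T) b) (≤-trans u≤ (m≤n+m _ (time p N G))))) ,
      weaken (+-monoʳ-≤ t (m≤n+m _ (pushes p N))) bq
  ... | _ · _
    with (u , ex , u≤) , bp ← halts p wp (≤-trans (+-monoʳ-≤ t (m≤m+n _ (pushes q N))) t≤T) b
    = (_ , cond-true (λ eq′ → nil≢cons (trans (sym eq′) eq)) ex ,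
        s≤s (+-mono-≤ (cost≤ e (≤-trans (m≤m+n t _) t≤T) b) (≤-trans u≤ (m≤m+n _ (time q N G))))) ,
      weaken (+-monoʳ-≤ t (m≤m+n _ (pushes q N))) bp
    where
    nil≢cons : ∀ {a b} → nil ≢ a · b
    nil≢cons ()
  halts (for x p) {s} {t} (lx≡0 , u , wp) t≤T b =
    halts-for x p (lookup s x) N lx≡0 u wp refl
      (subst (λ l → size (lookup s x) ≤ sizeBound N T l t) lx≡0 (register≤ b x)) ≤-refl t≤T b

  halts-for x p nil {s} {t} k lx≡0 unw wp s[x] v≤k k≤N t≤T b =
    (_ , while-false s[x] ,
      ≤-trans (s≤s (register≤G (≤-trans (m≤m+n t _) t≤T) b x)) (m≤n+m _ (k * roundTime p N G))) ,
    weaken (m≤m+n t _) b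
  halts-for x p (a · v) {s} {t} (suc k) lx≡0 unw wp s[x] (s≤s v≤k) k≤N t≤T b
    with t+p+k≤T ← ≤-trans (≤-reflexive (+-assoc t (pushes p N) (k * pushes p N))) t≤T
    with (u , ep , u≤) , bp ← halts p wp (≤-trans (m≤m+n _ (k * pushes p N)) t+p+k≤T) b
    with x≤G ← register≤G (≤-trans (m≤m+n _ (k * pushes p N)) t+p+k≤T) bp x
    -- The body leaves the loop register alone, so its tail afterwards is still `v`.
    with p[x] ← trans (lookup-run p s unw) s[x]
    with size-v ← ≤-trans (m≤n+m (size v) (size a)) v≤k
    with v≤ ← subst (λ l → size v ≤ sizeBound N T l (t + pushes p N)) (sym lx≡0)
                (≤-trans size-v (≤-trans (n≤1+n k) k≤N))
    with (u′ , ew , u′≤) , bw ←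
      halts-for x p v {run p s [ x ]≔ v} k lx≡0 unw wp (lookup∘updateAt x (run p s)) size-v
        (≤-trans (n≤1+n k) k≤N) t+p+k≤T (bounded (size-update (run p s) x (register≤ bp) v≤))
    = (_ , while-true (λ eq → case trans (sym eq) s[x] of λ ())
             (seq ep (subst (λ w → Exec (x ≔ tl (reg x)) (run p s) _ (run p s [ x ]≔ w))
                        (cong tail p[x]) assign)) ew ,
        (begin
          suc (size (lookup s x) + (u + suc (suc (size (lookup (run p s) x))) + u′))
            ≤⟨ s≤s (+-mono-≤ (register≤G (≤-trans (m≤m+n t _) t≤T) b x)
                      (+-mono-≤ (+-mono-≤ u≤ (s≤s (s≤s x≤G))) u′≤)) ⟩
          suc (G + (time p N G + suc (suc G) + (k * R + suc G)))
            ≡⟨ cong suc (+-assoc G _ _) ⟨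
          R + (k * R + suc G)
            ≡⟨ +-assoc R (k * R) (suc G) ⟨
          suc k * R + suc G ∎)) ,
      weaken (≤-reflexive (+-assoc t (pushes p N) (k * pushes p N))) bw
    where
    open ≤-Reasoning
    R = roundTime p N G

nonZero-size : ∀ t → NonZero (size t)
nonZero-size nil     = _
nonZero-size (_ · _) = _

-- With `pushes p` as the number of pushes, the size bound and then the time are polynomial in the
-- input size. The output expression may build trees freely, being evaluated only once.
levelled⇒polyTime : ∀ {A B : Set} {encA : A → Tree} {encB : B → Tree} {f : A → B} {n}
  (level : Fin (suc n) → ℕ) (L : ℕ) → (∀ x → level x ≤ L) →
  (p : Prog (suc n)) (e : Expr (suc n)) → Levelled level p →
  (∀ a → eval e (run p (encA a Vec.∷ replicate n nil)) ≡ encB (f a)) →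
  PolyTime encA encB f
levelled⇒polyTime {A} {encA = encA} {encB} {f} {n} level L level≤L p e wf correct
  with c , d , bound ← poly-+ (poly-time p (poly-sizeBound L (poly-pushes p)))
         (poly-suc (poly-* (poly-const (exprSize e)) (poly-sizeBound L (poly-pushes p))))
  = record { extra = n ; body = compile p ⨾ zero ≔ e } , c , d , runs
  where
  module _ (a : A) where
    N = size (encA a)
    T = pushes p N
    s = encA a Vec.∷ replicate n nil

    small : ∀ x → size (lookup s x) ≤ sizeBound N T (level x) 0
    small zero    = N≤sizeBound (level zero) 0
    small (suc x) = ≤-trans (≤-reflexive (cong size (lookup-replicate x nil)))
      (≤-trans (size>0 (encA a)) (N≤sizeBound (level (suc x)) 0))

    runs : ∃[ t ] Run (record { extra = n ; body = compile p ⨾ zero ≔ e }) (encA a) t (encB (f a)) ×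
      t ≤ c * N ^ d + c
    runs
      with (u , ex , u≤) , b ← halts level L level≤L N T (size>0 (encA a)) p wf ≤-refl (bounded small)
      = _ , (_ , seq ex assign , trans (lookup∘updateAt zero (run p s)) (correct a)) ,
        (≤-trans (+-mono-≤ u≤ (s≤s (cost≤ level L level≤L N T (size>0 (encA a)) e ≤-refl b)))
          (≤-trans (bound N {{nonZero-size (encA a)}}) (m≤m+n _ c)))

-- The reduction program

-- Pushing builds lists in reverse, so a loop that pushes selected elements computes `_ʳ++_`; this
-- is one round, in the shape required by `result-∷`.
map-filter-ʳ++ : ∀ {A B : Set} {P : A → Set} (f : A → B) (P? : ∀ x → Dec (P x)) x xs ys →
  map f (filter P? (x ∷ xs)) ʳ++ ys ≡
  map f (filter P? xs) ʳ++ (if does (P? x) then f x ∷ ys else ys)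
map-filter-ʳ++ f P? x xs ys with does (P? x)
... | true  = refl
... | false = refl

filter-ʳ++ : ∀ {A : Set} {P : A → Set} (P? : ∀ x → Dec (P x)) x xs ys →
  filter P? (x ∷ xs) ʳ++ ys ≡ filter P? xs ʳ++ (if does (P? x) then x ∷ ys else ys)
filter-ʳ++ P? x xs ys with does (P? x)
... | true  = refl
... | false = refl

-- σ v s is the store in which the loop register holds v, and s is the rest.
module _ {n : ℕ} {A X : Set} (x : Fin n) (p : Prog n) (enc : A → Tree) (σ : Tree → X → Store n)
         (step : A → X → X) (result : List A → X → X)
         (update : ∀ {v w s} → σ v s [ x ]≔ w ≡ σ w s)
         (run-body : ∀ a as s →
           run p (σ (encList enc (a ∷ as)) s) ≡ σ (encList enc (a ∷ as)) (step a s))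
         (result-[] : ∀ s → result [] s ≡ s)
         (result-∷ : ∀ a as s → result (a ∷ as) s ≡ result as (step a s)) where

  -- The hypotheses make `result` the left fold of `step`, so a loop is verified by checking a
  -- single round.
  iterate-encList : ∀ as s →
    iterate x (run p) (encList enc as) (σ (encList enc as) s) ≡ σ nil (result as s)
  iterate-encList []       s = cong (σ nil) (sym (result-[] s))
  iterate-encList (a ∷ as) s = begin
    iterate x (run p) v (run p (σ (enc a · v) s) [ x ]≔ v)
      ≡⟨ cong (λ t → iterate x (run p) v (t [ x ]≔ v)) (run-body a as s) ⟩
    iterate x (run p) v (σ (enc a · v) (step a s) [ x ]≔ v)
      ≡⟨ cong (iterate x (run p) v) update ⟩
    iterate x (run p) v (σ v (step a s))
      ≡⟨ iterate-encList as (step a s) ⟩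
    σ nil (result as (step a s))
      ≡⟨ cong (σ nil) (result-∷ a as s) ⟨
    σ nil (result (a ∷ as) s) ∎
    where
    open ≡-Reasoning
    v = encList enc as

-- Equality of encoded variables

encBin-injective : ∀ a b → encBin a ≡ encBin b → a ≡ b
encBin-injective zero     zero     eq = refl
encBin-injective 2[1+ a ] 2[1+ b ] eq = cong 2[1+_] (encBin-injective a b (cong tail eq))
encBin-injective 2[1+ a ] 1+[2 b ] ()
encBin-injective 1+[2 a ] 2[1+ b ] ()
encBin-injective 1+[2 a ] 1+[2 b ] eq = cong 1+[2_] (encBin-injective a b (cong tail eq))

encVar-injective : ∀ {x y} → encVar x ≡ encVar y → x ≡ y
encVar-injective eq = ℕᵇ.fromℕ-injective (encBin-injective _ _ eq)

equal-refl : ∀ t → equal t t ≡ true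
equal-refl nil     = refl
equal-refl (a · b) rewrite equal-refl a | equal-refl b = refl

equal-sound : ∀ t u → equal t u ≡ true → t ≡ u
equal-sound nil     nil     eq = refl
equal-sound (a · b) (c · d) eq with equal a c in ac
... | true = cong₂ _·_ (equal-sound a c ac) (equal-sound b d eq)

equal-encVar : ∀ x y → equal (encVar x) (encVar y) ≡ does (x ≟ y)
equal-encVar x y with x ≟ y
... | yes refl = trans (equal-refl (encVar x)) (sym (dec-true (x ≟ x) refl))
... | no  x≢y with equal (encVar x) (encVar y) in eq
...   | true  = contradiction (encVar-injective (equal-sound _ _ eq)) x≢y
...   | false = sym (dec-false (x ≟ y) x≢y)

encVars : List Var → Tree
encVars = encList encVar

-- `take 1 ms` is the set of exempt variables in both uses of `scan`: empty for the kept clauses,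
-- the current target otherwise.
equal-head : ∀ x ms → equal (encVar x · tail (encVars ms)) (encVars ms) ≡ does (x ∈? take 1 ms)
equal-head x []       = refl
equal-head x (m ∷ ms) rewrite equal-encVar x m | equal-refl (encVars ms) =
  trans (Bool.∧-identityʳ _) (sym (Bool.∨-identityʳ _))

-- Registers and code

input targets clausesLeft varsLeft hypsLeft var found hit bad term disj disjsOut clausesOut : Fin 13
input       = # 0
targets     = # 1
clausesLeft = # 2
varsLeft    = # 3
hypsLeft    = # 4
var         = # 5
found       = # 6
hit         = # 7
bad         = # 8
term        = # 9
disj        = # 10
disjsOut    = # 11
clausesOut  = # 12

-- Levels rise along pushes: `var` feeds `term`, `term` feeds `disj` and `clausesOut`, and `disj`
-- feeds `disjsOut`.
level : Fin 13 → ℕ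
level = lookup (0 ∷ 0 ∷ 0 ∷ 0 ∷ 0 ∷ 0 ∷ 0 ∷ 0 ∷ 0 ∷ 1 ∷ 2 ∷ 3 ∷ 2 ∷ [])

-- The input is never nil and so serves as the truth value of flags.  Each
-- subprogram resets its scratch registers to nil, so that stores are known
-- exactly.
checkHyp testHyp : Prog 13
checkHyp = cond (reg var =? hd (reg hypsLeft)) (found ⊲ reg input) skip
testHyp  = hypsLeft ⊲ hd (tl (reg input)) then for hypsLeft checkHyp

-- The comparison succeeds iff targets is non-empty with head var; with no
-- targets left, scan thus classifies the clause without exempting a variable.
checkVar scan : Prog 13
checkVar =
  var ⊲ hd (reg varsLeft) then
  cond (cons (reg var) (tl (reg targets)) =? reg targets)
    (hit ⊲ reg input)
    (push term (reg var) then
     testHyp then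
     cond (reg found) (found ⊲ nil) (bad ⊲ reg input)) then
  var ⊲ nil
scan = varsLeft ⊲ hd (reg clausesLeft) then for varsLeft checkVar

resetScan : Prog 13
resetScan = hit ⊲ nil then bad ⊲ nil then term ⊲ nil

recordClause keepClause : Prog 13
recordClause = cond (reg bad) skip (push clausesOut (hd (reg clausesLeft))) then resetScan
keepClause   = scan then recordClause

recordTerm addTerm : Prog 13
recordTerm = cond (reg hit) (cond (reg bad) skip (push disj (reg term))) skip then resetScan
addTerm    = scan then recordTerm

recordDisj recordTarget treatTarget : Prog 13
recordDisj   = push disjsOut (reg disj) then disj ⊲ nil
recordTarget =
  cond (reg found)
    -- A pushed expression must not contain `cons`, so the unit clause is first assembled in `term`.
    (push term (reg var) then push clausesOut (reg term) then
     term ⊲ nil then found ⊲ nil then var ⊲ nil)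
    (var ⊲ nil then
     clausesLeft ⊲ hd (reg input) then for clausesLeft addTerm then
     recordDisj)
treatTarget  = var ⊲ hd (reg targets) then testHyp then recordTarget

treatTargets reduction : Prog 13
treatTargets = targets ⊲ tl (tl (reg input)) then for targets treatTarget
reduction    =
  clausesLeft ⊲ hd (reg input) then for clausesLeft keepClause then treatTargets

level≤3 : ∀ x → level x ≤ 3
level≤3 = from-yes (Fin.all? λ x → level x ≤? 3)

reduction-levelled : Levelled level reduction
reduction-levelled = from-yes (levelled? level reduction)

-- The reduction on instances

Hit : List Var → List Var → Set
Hit ys c = Any (_∈ ys) c

hit? : ∀ ys c → Dec (Hit ys c)
hit? ys = Any.any? (_∈? ys)

-- For `ys = [ m ]` this is the clause without `m`, that is, the variables that must be false for it
-- to force `m`.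
residue : List Var → List Var → List Var
residue ys c = reverse (filter (λ x → ¬? (x ∈? ys)) c)

module _ (H : List Var) where

  -- With `ys` empty this says that the clause leaves `H`, with `ys = [ m ]` that it does so at a
  -- variable other than `m`.
  Stray : List Var → List Var → Set
  Stray ys c = Any (λ x → ¬ x ∈ ys × ¬ x ∈ H) c

  stray? : ∀ ys c → Dec (Stray ys c)
  stray? ys = Any.any? (λ x → ¬? (x ∈? ys) ×-dec ¬? (x ∈? H))

  module _ {k : ℕ} where

    Kept : Vec Var k → Set
    Kept c = ¬ Stray [] (Vec.toList c)

    kept? : ∀ c → Dec (Kept c)
    kept? c = ¬? (stray? [] (Vec.toList c))

    Forcing : Var → Vec Var k → Set
    Forcing m c = Hit [ m ] (Vec.toList c) × ¬ Stray [ m ] (Vec.toList c)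

    forcing? : ∀ m c → Dec (Forcing m c)
    forcing? m c = hit? [ m ] (Vec.toList c) ×-dec ¬? (stray? [ m ] (Vec.toList c))

    -- An empty list is a false disjunction: nothing can force `m`. An empty term, from a clause
    -- with no variable but `m`, is true.
    forcers : CNF⁺ k → Var → List (List Var)
    forcers KB m = reverse (map (residue [ m ] ∘ Vec.toList) (filter (forcing? m) KB))

module _ {k : ℕ} (1≤k : 1 ≤ k) where

  unit : Var → Vec≤ Var k
  unit m = (m ∷ []) Vec≤., 1≤k

  -- The reversals reproduce the order in which the program pushes its output, so that the encodings
  -- agree exactly.
  reduce : AbdInstance k → SimpleInstance k
  reduce I = record
    { clauses      = map unit (filter (_∈? H) M) ʳ++ reverse (map Vec≤.fromVec (filter (kept? H) KB))
    ; disjunctions = reverse (map (forcers H KB) (filter (λ m → ¬? (m ∈? H)) M))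
    }
    where open AbdInstance I

-- The program computes the reduction

module _ {k : ℕ} (1≤k : 1 ≤ k) (I : AbdInstance k) where
  open AbdInstance I

  flag : Bool → Tree
  flag b = if b then encAbd I else nil

  store : (ms cs xs hs x f i b t d ds cl : Tree) → Store 13
  store ms cs xs hs x f i b t d ds cl =
    encAbd I ∷ ms ∷ cs ∷ xs ∷ hs ∷ x ∷ f ∷ i ∷ b ∷ t ∷ d ∷ ds ∷ cl ∷ []

  module _ {ms cs xs i b t d ds cl : Tree} (x : Var) where

    hyps-loop : ∀ hs a →
      iterate hypsLeft (run checkHyp) (encVars hs)
        (store ms cs xs (encVars hs) (encVar x) (flag a) i b t d ds cl) ≡
      store ms cs xs nil (encVar x) (flag (a ∨ does (x ∈? hs))) i b t d ds cl
    hyps-loop [] a rewrite Bool.∨-identityʳ a = refl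
    hyps-loop (h ∷ hs) a rewrite equal-encVar x h with does (x ≟ h)
    ... | true  rewrite Bool.∨-zeroʳ a = hyps-loop hs true
    ... | false = hyps-loop hs a

    run-testHyp :
      run testHyp (store ms cs xs nil (encVar x) nil i b t d ds cl) ≡
      store ms cs xs nil (encVar x) (flag (does (x ∈? H))) i b t d ds cl
    run-testHyp = hyps-loop H false

  -- The part of `checkVar` after `testHyp`; its run agrees by definition, although `checkVar`
  -- groups the commands differently.
  settle : Prog 13
  settle = cond (reg found) (found ⊲ nil) (bad ⊲ reg input) then var ⊲ nil

  run-settle : ∀ {ms cs xs hs x i t d ds cl} b y →
    run settle (store ms cs xs hs x (flag y) i (flag b) t d ds cl) ≡
    store ms cs xs hs nil nil i (flag (b ∨ (true ∧ not y))) t d ds cl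
  run-settle b true  rewrite Bool.∨-identityʳ b = refl
  run-settle b false rewrite Bool.∨-zeroʳ b = refl

  module _ {cs d ds cl : Tree} (ms : List Var) where

    private
      ys = take 1 ms
      scanStore : (xs : Tree) (i b : Bool) (t : List Var) → Store 13
      scanStore xs i b t = store (encVars ms) cs xs nil nil nil (flag i) (flag b) (encVars t) d ds cl

    run-checkVar : ∀ x v i b t →
      run checkVar (scanStore (encVar x · v) i b t) ≡
      scanStore (encVar x · v) (i ∨ does (x ∈? ys))
        (b ∨ (not (does (x ∈? ys)) ∧ not (does (x ∈? H))))
        (if not (does (x ∈? ys)) then x ∷ t else t)
    run-checkVar x v i b t rewrite equal-head x ms with does (x ∈? ys)
    ... | true  rewrite Bool.∨-zeroʳ i | Bool.∨-identityʳ b = refl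
    ... | false rewrite Bool.∨-identityʳ i =
      trans (cong (run settle) (run-testHyp x)) (run-settle b (does (x ∈? H)))

    run-scan : ∀ xs {v} → cs ≡ encVars xs · v →
      run scan (store (encVars ms) cs nil nil nil nil nil nil nil d ds cl) ≡
      store (encVars ms) cs nil nil nil nil (flag (does (hit? ys xs)))
        (flag (does (stray? H ys xs))) (encVars (residue ys xs)) d ds cl
    run-scan xs refl = iterate-encList {X = Bool × Bool × List Var} varsLeft checkVar encVar
      (λ { v (i , b , t) → scanStore v i b t })
      (λ { x (i , b , t) → i ∨ does (x ∈? ys) ,
                           b ∨ (not (does (x ∈? ys)) ∧ not (does (x ∈? H))) ,
                           (if not (does (x ∈? ys)) then x ∷ t else t) })
      (λ { xs (i , b , t) → i ∨ does (hit? ys xs) , b ∨ does (stray? H ys xs) ,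
                            filter (λ x → ¬? (x ∈? ys)) xs ʳ++ t })
      refl
      (λ { x xs (i , b , t) → run-checkVar x (encVars xs) i b t })
      (λ { (i , b , t) → cong₂ (λ i b → i , b , t) (Bool.∨-identityʳ i) (Bool.∨-identityʳ b) })
      (λ { x xs (i , b , t) → cong₂ _,_ (sym (Bool.∨-assoc i _ _))
             (cong₂ _,_ (sym (Bool.∨-assoc b _ _)) (filter-ʳ++ (λ x → ¬? (x ∈? ys)) x xs t)) })
      xs (false , false , [])

  private
    encClauses : List (Vec≤ Var k) → Tree
    encClauses = encList (encVars ∘ Vec≤.toList)

    encKB : CNF⁺ k → Tree
    encKB = encList (encVars ∘ Vec.toList)

    encDisj : List (List Var) → Tree
    encDisj = encList encVars

    idle : (ms cs x d ds : Tree) (cl : List (Vec≤ Var k)) → Store 13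
    idle ms cs x d ds cl = store ms cs nil nil x nil nil nil nil d ds (encClauses cl)

  run-keepClause : ∀ {d ds} c v cl →
    run keepClause (idle nil (encVars (Vec.toList c) · v) nil d ds cl) ≡
    idle nil (encVars (Vec.toList c) · v) nil d ds
      (if does (kept? H c) then Vec≤.fromVec c ∷ cl else cl)
  run-keepClause c v cl =
    trans (cong (run recordClause) (run-scan [] (Vec.toList c) refl))
      (finish (does (hit? [] (Vec.toList c))) (does (stray? H [] (Vec.toList c))))
    where
    -- With the test results abstracted to Booleans, the conditionals reduce in each case, since a
    -- true flag is a pair.
    finish : ∀ {t d ds} i b →
      run recordClause (store nil (encVars (Vec.toList c) · v) nil nil nil nil (flag i) (flag b) t
        d ds (encClauses cl)) ≡
      idle nil (encVars (Vec.toList c) · v) nil d ds (if not b then Vec≤.fromVec c ∷ cl else cl)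
    finish i true  = refl
    finish i false = refl

  keep-loop : ∀ {d ds} kb cl →
    iterate clausesLeft (run keepClause) (encKB kb) (idle nil (encKB kb) nil d ds cl) ≡
    idle nil nil nil d ds (map Vec≤.fromVec (filter (kept? H) kb) ʳ++ cl)
  keep-loop {d} {ds} = iterate-encList {A = Vec Var k} clausesLeft keepClause (encVars ∘ Vec.toList)
    (λ v cl → idle nil v nil d ds cl)
    (λ c cl → if does (kept? H c) then Vec≤.fromVec c ∷ cl else cl)
    (λ kb cl → map Vec≤.fromVec (filter (kept? H) kb) ʳ++ cl)
    refl (λ c kb → run-keepClause c (encKB kb)) (λ _ → refl) (map-filter-ʳ++ Vec≤.fromVec (kept? H))

  module _ {ds : Tree} {cl : List (Vec≤ Var k)} (m : Var) (ms : List Var) where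

    run-addTerm : ∀ (c : Vec Var k) v d →
      run addTerm (idle (encVars (m ∷ ms)) (encVars (Vec.toList c) · v) nil (encDisj d) ds cl) ≡
      idle (encVars (m ∷ ms)) (encVars (Vec.toList c) · v) nil
        (encDisj (if does (forcing? H m c) then residue [ m ] (Vec.toList c) ∷ d else d)) ds cl
    run-addTerm c v d =
      trans (cong (run recordTerm) (run-scan (m ∷ ms) (Vec.toList c) refl))
        (finish (does (hit? [ m ] (Vec.toList c))) (does (stray? H [ m ] (Vec.toList c))))
      where
      finish : ∀ {ms cs t} i b →
        run recordTerm (store ms cs nil nil nil nil (flag i) (flag b) (encVars t)
          (encDisj d) ds (encClauses cl)) ≡
        idle ms cs nil (encDisj (if i ∧ not b then t ∷ d else d)) ds cl
      finish true  true  = refl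
      finish true  false = refl
      finish false b     = refl

    term-loop : ∀ kb d →
      iterate clausesLeft (run addTerm) (encKB kb)
        (idle (encVars (m ∷ ms)) (encKB kb) nil (encDisj d) ds cl) ≡
      idle (encVars (m ∷ ms)) nil nil
        (encDisj (map (residue [ m ] ∘ Vec.toList) (filter (forcing? H m) kb) ʳ++ d)) ds cl
    term-loop = iterate-encList {A = Vec Var k} clausesLeft addTerm (encVars ∘ Vec.toList)
      (λ v d → idle (encVars (m ∷ ms)) v nil (encDisj d) ds cl)
      (λ c d → if does (forcing? H m c) then residue [ m ] (Vec.toList c) ∷ d else d)
      (λ kb d → map (residue [ m ] ∘ Vec.toList) (filter (forcing? H m) kb) ʳ++ d)
      refl (λ c kb → run-addTerm c (encKB kb)) (λ _ → refl)
      (map-filter-ʳ++ (residue [ m ] ∘ Vec.toList) (forcing? H m))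

  run-treatTarget : ∀ m ms {ds} cl →
    run treatTarget (idle (encVars (m ∷ ms)) nil nil nil (encList encDisj ds) cl) ≡
    idle (encVars (m ∷ ms)) nil nil nil
      (encList encDisj (if not (does (m ∈? H)) then forcers H KB m ∷ ds else ds))
      (if does (m ∈? H) then unit 1≤k m ∷ cl else cl)
  run-treatTarget m ms {ds} cl =
    trans (cong (run recordTarget) (run-testHyp m)) (finish (does (m ∈? H)))
    where
    finish : ∀ y →
      run recordTarget (store (encVars (m ∷ ms)) nil nil nil (encVar m) (flag y) nil nil nil nil
        (encList encDisj ds) (encClauses cl)) ≡
      idle (encVars (m ∷ ms)) nil nil nil
        (encList encDisj (if not y then forcers H KB m ∷ ds else ds))
        (if y then unit 1≤k m ∷ cl else cl)
    finish true  = refl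
    finish false = cong (run recordDisj) (term-loop m ms KB [])

  target-loop : ∀ ms ds cl →
    iterate targets (run treatTarget) (encVars ms)
      (idle (encVars ms) nil nil nil (encList encDisj ds) cl) ≡
    idle nil nil nil nil
      (encList encDisj (map (forcers H KB) (filter (λ m → ¬? (m ∈? H)) ms) ʳ++ ds))
      (map (unit 1≤k) (filter (_∈? H) ms) ʳ++ cl)
  target-loop ms ds cl = iterate-encList {X = List (List (List Var)) × List (Vec≤ Var k)} targets treatTarget encVar
    (λ { v (ds , cl) → idle v nil nil nil (encList encDisj ds) cl })
    (λ { m (ds , cl) → (if not (does (m ∈? H)) then forcers H KB m ∷ ds else ds) ,
                       (if does (m ∈? H) then unit 1≤k m ∷ cl else cl) })
    (λ { ms (ds , cl) → map (forcers H KB) (filter (λ m → ¬? (m ∈? H)) ms) ʳ++ ds ,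
                        map (unit 1≤k) (filter (_∈? H) ms) ʳ++ cl })
    refl
    (λ { m ms (ds , cl) → run-treatTarget m ms cl })
    (λ _ → refl)
    (λ { m ms (ds , cl) → cong₂ _,_
           (map-filter-ʳ++ (forcers H KB) (λ m → ¬? (m ∈? H)) m ms ds)
           (map-filter-ʳ++ (unit 1≤k) (_∈? H) m ms cl) })
    ms (ds , cl)

  run-reduction : eval (cons (reg clausesOut) (reg disjsOut))
    (run reduction (encAbd I ∷ Vec.replicate 12 nil)) ≡ encSimple (reduce 1≤k I)
  run-reduction = cong (eval (cons (reg clausesOut) (reg disjsOut)))
    (trans (cong (run treatTargets) (keep-loop KB [])) (target-loop M [] _))

reduce-polyTime : ∀ {k} (1≤k : 1 ≤ k) → PolyTime encAbd encSimple (reduce 1≤k)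
reduce-polyTime 1≤k = levelled⇒polyTime {encA = encAbd} {encSimple} {reduce 1≤k} level 3 level≤3
  reduction (cons (reg clausesOut) (reg disjsOut)) reduction-levelled (run-reduction 1≤k)

-- Correctness

unique-⊆-length : ∀ {xs ys : List Var} → Unique xs → xs ⊆ ys → length xs ≤ length ys
unique-⊆-length []         xs⊆ys = z≤n
unique-⊆-length {x ∷ xs} (x∉xs ∷ u) xs⊆ys with as , bs , refl ← ∈-∃++ (xs⊆ys (here refl)) =
  ≤-trans (s≤s (unique-⊆-length u rest))
    (≤-reflexive (trans (cong suc (length-++ as)) (trans (sym (+-suc _ _)) (sym (length-++ as)))))
  where
  -- By uniqueness `x` does not recur in `xs`, so one occurrence of it can be deleted from `ys`.
  rest : xs ⊆ as ++ bs
  rest z∈xs with ∈-++⁻ as (xs⊆ys (there z∈xs))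
  ... | inj₁ z∈as         = ∈-++⁺ˡ z∈as
  ... | inj₂ (here refl)  = contradiction refl (All.lookup x∉xs z∈xs)
  ... | inj₂ (there z∈bs) = ∈-++⁺ʳ as z∈bs

card-mono : ∀ {xs ys} → xs ⊆ ys → card xs ≤ card ys
card-mono {xs} {ys} xs⊆ys = unique-⊆-length (deduplicate-! _≟_ xs)
  (∈-deduplicate⁺ _≟_ ∘ xs⊆ys ∘ ∈-deduplicate⁻ _≟_ xs)

module _ {A B : Set} {P : A → Set} (P? : ∀ x → Dec (P x)) {f : A → B} {xs : List A} where

  ∈-map-filter⁺ : ∀ {x} → x ∈ xs → P x → f x ∈ map f (filter P? xs)
  ∈-map-filter⁺ x∈xs px = ∈-map⁺ f (∈-filter⁺ P? x∈xs px)

  ∈-map-filter⁻ : ∀ {y} → y ∈ map f (filter P? xs) → ∃[ x ] x ∈ xs × P x × y ≡ f x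
  ∈-map-filter⁻ y∈ with x , x∈ , y≡fx ← ∈-map⁻ f y∈ with x∈xs , px ← ∈-filter⁻ P? x∈ =
    x , x∈xs , px , y≡fx

∈-residue⁺ : ∀ {ys c x} → x ∈ c → ¬ x ∈ ys → x ∈ residue ys c
∈-residue⁺ x∈c x∉ys = Any.reverse⁺ (∈-filter⁺ (λ x → ¬? (x ∈? _)) x∈c x∉ys)

∈-residue⁻ : ∀ {ys c x} → x ∈ residue ys c → x ∈ c × ¬ x ∈ ys
∈-residue⁻ x∈ = ∈-filter⁻ (λ x → ¬? (x ∈? _)) (Any.reverse⁻ x∈)

¬stray⇒∈H : ∀ {H ys c x} → ¬ Stray H ys c → x ∈ c → ¬ x ∈ ys → x ∈ H
¬stray⇒∈H {H} {x = x} ¬stray x∈c x∉ys =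
  decidable-stable (x ∈? H) λ x∉H → ¬stray (lose x∈c (x∉ys , x∉H))

∉[m] : ∀ {x m : Var} → x ≢ m → ¬ x ∈ [ m ]
∉[m] x≢m (here eq) = x≢m eq

-- Assignments and literals over `H`

extend : List Var → Assignment → Assignment → Assignment
extend H τ ρ x = if does (x ∈? H) then τ x else ρ x

module _ {H : List Var} (τ ρ : Assignment) {x : Var} where

  extend-∈ : x ∈ H → extend H τ ρ x ≡ τ x
  extend-∈ x∈H rewrite dec-true (x ∈? H) x∈H = refl

  extend-∉ : ¬ x ∈ H → extend H τ ρ x ≡ ρ x
  extend-∉ x∉H rewrite dec-false (x ∈? H) x∉H = refl

literal : Assignment → Var → Literal
literal τ x = if τ x then pos x else neg x

sat-literal⁺ : ∀ τ {σ : Assignment} {x} → σ x ≡ τ x → SatLit σ (literal τ x)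
sat-literal⁺ τ {x = x} eq with τ x
... | true  = eq
... | false = eq

sat-literal⁻ : ∀ τ {σ x} → SatLit σ (literal τ x) → σ x ≡ τ x
sat-literal⁻ τ {x = x} sat with τ x
... | true  = sat
... | false = sat

literals⊆ : ∀ {H} τ → map (literal τ) H ⊆ map pos H ++ map neg H
literals⊆ {H} τ l∈ with x , x∈H , refl ← ∈-map⁻ (literal τ) l∈ with τ x
... | true  = ∈-++⁺ˡ (∈-map⁺ pos x∈H)
... | false = ∈-++⁺ʳ (map pos H) (∈-map⁺ neg x∈H)

-- `E` mentions only variables of `H`, so changes elsewhere do not affect it.
sat-literals-cong : ∀ {H E τ σ} → E ⊆ map pos H ++ map neg H → (∀ {x} → x ∈ H → σ x ≡ τ x) →
  All (SatLit τ) E → All (SatLit σ) E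
sat-literals-cong {H} {E} {τ} {σ} E⊆ agree satE = All.tabulate λ l∈E → sat (E⊆ l∈E) (All.lookup satE l∈E)
  where
  sat : ∀ {l} → l ∈ map pos H ++ map neg H → SatLit τ l → SatLit σ l
  sat l∈ τl with ∈-++⁻ (map pos H) l∈
  ... | inj₁ l∈pos with _ , x∈H , refl ← ∈-map⁻ pos l∈pos = trans (agree x∈H) τl
  ... | inj₂ l∈neg with _ , x∈H , refl ← ∈-map⁻ neg l∈neg = trans (agree x∈H) τl

true≢false : ∀ {b} → b ≡ true → b ≢ false
true≢false refl ()

-- Variables and models of the reduced instance

module _ {k : ℕ} (1≤k : 1 ≤ k) (I : AbdInstance k) where
  open AbdInstance I
  open SimpleInstance (reduce 1≤k I) using (clauses; disjunctions)

  ∈-clauses⁻ : ∀ {c} → c ∈ clauses →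
    (∃[ m ] m ∈ M × m ∈ H × c ≡ unit 1≤k m) ⊎ (∃[ C ] C ∈ KB × Kept H C × c ≡ Vec≤.fromVec C)
  ∈-clauses⁻ c∈ with Any.reverseAcc⁻ _ (map (unit 1≤k) (filter (_∈? H) M)) c∈
  ... | inj₁ c∈kept = inj₂ (∈-map-filter⁻ (kept? H) (Any.reverse⁻ c∈kept))
  ... | inj₂ c∈unit = inj₁ (∈-map-filter⁻ (_∈? H) c∈unit)

  unit∈clauses : ∀ {m} → m ∈ M → m ∈ H → unit 1≤k m ∈ clauses
  unit∈clauses m∈M m∈H = Any.reverseAcc⁺ _ (map (unit 1≤k) (filter (_∈? H) M))
    (inj₂ (∈-map-filter⁺ (_∈? H) m∈M m∈H))

  kept∈clauses : ∀ {C} → C ∈ KB → Kept H C → Vec≤.fromVec C ∈ clauses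
  kept∈clauses C∈KB kept = Any.reverseAcc⁺ _ (map (unit 1≤k) (filter (_∈? H) M))
    (inj₁ (Any.reverse⁺ (∈-map-filter⁺ (kept? H) C∈KB kept)))

  ∈-disjunctions⁻ : ∀ {d} → d ∈ disjunctions → ∃[ m ] m ∈ M × ¬ m ∈ H × d ≡ forcers H KB m
  ∈-disjunctions⁻ d∈ = ∈-map-filter⁻ (λ m → ¬? (m ∈? H)) (Any.reverse⁻ d∈)

  forcers∈disjunctions : ∀ {m} → m ∈ M → ¬ m ∈ H → forcers H KB m ∈ disjunctions
  forcers∈disjunctions m∈M m∉H =
    Any.reverse⁺ (∈-map-filter⁺ (λ m → ¬? (m ∈? H)) m∈M m∉H)

  ∈-forcers⁻ : ∀ {m t} → t ∈ forcers H KB m →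
    ∃[ C ] C ∈ KB × Forcing H m C × t ≡ residue [ m ] (Vec.toList C)
  ∈-forcers⁻ {m} t∈ = ∈-map-filter⁻ (forcing? H m) (Any.reverse⁻ t∈)

  ∈-forcers⁺ : ∀ {m C} → C ∈ KB → Forcing H m C → residue [ m ] (Vec.toList C) ∈ forcers H KB m
  ∈-forcers⁺ {m} C∈KB forcing = Any.reverse⁺ (∈-map-filter⁺ (forcing? H m) C∈KB forcing)

  -- Unit clauses come from `M` inside `H`, kept clauses have no stray variable, and a forcing
  -- clause can leave `H` only at `m`, which its residue omits.
  simpleVars⊆H : simpleVars (reduce 1≤k I) ⊆ H
  simpleVars⊆H x∈ with ∈-++⁻ (concat (map Vec≤.toList clauses)) x∈
  simpleVars⊆H x∈ | inj₁ x∈cl with _ , x∈c , c∈ ← ∈-concat⁻′ (map Vec≤.toList clauses) x∈cl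
    with c , c∈cl , refl ← ∈-map⁻ Vec≤.toList c∈ with ∈-clauses⁻ c∈cl
  ... | inj₁ (m , _ , m∈H , refl) with here refl ← x∈c = m∈H
  ... | inj₂ (C , _ , kept , refl) = ¬stray⇒∈H kept x∈c λ ()
  simpleVars⊆H x∈ | inj₂ x∈ds with t , x∈t , t∈ ← ∈-concat⁻′ (concat disjunctions) x∈ds
    with d , t∈d , d∈ ← ∈-concat⁻′ disjunctions t∈
    with m , _ , _ , refl ← ∈-disjunctions⁻ d∈
    with C , _ , (_ , ¬stray) , refl ← ∈-forcers⁻ t∈d
    with x∈C , x∉m ← ∈-residue⁻ x∈t = ¬stray⇒∈H ¬stray x∈C x∉m

  card-bound : card (simpleVars (reduce 1≤k I)) ≤ card (abdVars I)
  card-bound = card-mono (∈-++⁺ʳ (concat (map Vec.toList KB)) ∘ ∈-++⁺ˡ ∘ simpleVars⊆H)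

  -- If no clause of KB forces m, then KB survives setting m to false and
  -- every other variable outside H to true.
  allBut : Var → Assignment
  allBut m x = not (does (x ≟ m))

  avoiding-sat : ∀ {m τ} → ¬ m ∈ H → SatCNF⁺ τ KB → ¬ Any (SatNegTerm τ) (forcers H KB m) →
    SatCNF⁺ (extend H τ (allBut m)) KB
  avoiding-sat {m} {τ} m∉H satKB unforced = All.tabulate sat
    where
    sat : ∀ {C} → C ∈ KB → SatPosClause (extend H τ (allBut m)) (Vec.toList C)
    sat {C} C∈KB with stray? H [ m ] (Vec.toList C)
    -- A variable outside `H` other than `m` is set to true.
    ... | yes stray with x , x∈C , x∉m , x∉H ← find stray =
      lose x∈C (trans (extend-∉ τ (allBut m) x∉H) (cong not (dec-false (x ≟ m) (x∉m ∘ here))))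
    ... | no ¬stray with hit? [ m ] (Vec.toList C)
    -- `C` is forcing, so its term fails under `τ`: some variable of `C` in `H` other than `m` is
    -- true.
    ...   | yes hit
        with x , x∈t , τx≢false ← find (¬All⇒Any¬ (λ x → τ x Bool.≟ false) _
               (unforced ∘ lose (∈-forcers⁺ C∈KB (hit , ¬stray))))
        with x∈C , x∉m ← ∈-residue⁻ x∈t =
      lose x∈C (trans (extend-∈ τ (allBut m) (¬stray⇒∈H ¬stray x∈C x∉m)) (Bool.¬-not τx≢false))
    -- `C` lies inside `H`, where the extension agrees with `τ`.
    ...   | no ¬hit with x , x∈C , τx ← find (All.lookup satKB C∈KB) =
      lose x∈C (trans (extend-∈ τ (allBut m) (¬stray⇒∈H ¬stray x∈C (¬hit ∘ lose x∈C))) τx)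

  -- Any model of `KB` and `E` serves: entailment yields the unit clauses, and by `avoiding-sat`
  -- also the disjunctions.
  explanation⇒model : ∃[ E ] IsExplanation I E → ∃[ τ ] SatSimple (reduce 1≤k I) τ
  explanation⇒model (E , E⊆ , (τ , satKB , satE) , entails) =
    τ , All.tabulate clause , All.tabulate disjunction
    where
    clause : ∀ {c} → c ∈ clauses → SatPosClause τ (Vec≤.toList c)
    clause c∈ with ∈-clauses⁻ c∈
    ... | inj₁ (m , m∈M , _ , refl) = here (entails m m∈M τ (satKB , satE))
    ... | inj₂ (C , C∈KB , _ , refl) = All.lookup satKB C∈KB

    disjunction : ∀ {d} → d ∈ disjunctions → Any (SatNegTerm τ) d
    disjunction d∈ with m , m∈M , m∉H , refl ← ∈-disjunctions⁻ d∈ =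
      -- If all terms failed, the extension by `allBut m` would be a model of `KB` and `E` with `m`
      -- false.
      decidable-stable (Any.any? (All.all? λ x → τ x Bool.≟ false) (forcers H KB m)) λ unforced →
        true≢false
          (entails m m∈M (extend H τ (allBut m))
            (avoiding-sat m∉H satKB unforced , sat-literals-cong {H} E⊆ (extend-∈ τ (allBut m)) satE))
          (trans (extend-∉ τ (allBut m) m∉H) (cong not (dec-true (m ≟ m) refl)))

  -- The explanation fixes all of `H` as in `τ`. Setting everything else to true shows consistency,
  -- and every model of the explanation agrees with `τ` on `H`.
  model⇒explanation : ∃[ τ ] SatSimple (reduce 1≤k I) τ → ∃[ E ] IsExplanation I E
  model⇒explanation (τ , satC , satD) =
    map (literal τ) H , literals⊆ τ ,
    (extend H τ (λ _ → true) , All.tabulate clause , map⁺ (All.tabulate (sat-literal⁺ τ ∘ extend-∈ τ (λ _ → true)))) ,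
    entails
    where
    clause : ∀ {C} → C ∈ KB → SatPosClause (extend H τ (λ _ → true)) (Vec.toList C)
    clause {C} C∈KB with stray? H [] (Vec.toList C)
    ... | yes stray with x , x∈C , _ , x∉H ← find stray = lose x∈C (extend-∉ τ (λ _ → true) x∉H)
    ... | no  kept  with x , x∈C , τx ← find (All.lookup satC (kept∈clauses C∈KB kept)) =
      lose x∈C (trans (extend-∈ τ (λ _ → true) (¬stray⇒∈H kept x∈C λ ())) τx)

    entails : ∀ m → m ∈ M → ∀ σ → SatKB∧ I (map (literal τ) H) σ → σ m ≡ true
    entails m m∈M σ (satKB , satE) with m ∈? H
    ... | yes m∈H with here τm ← All.lookup satC (unit∈clauses m∈M m∈H) =
      trans (sat-literal⁻ τ (All.lookup satE (∈-map⁺ (literal τ) m∈H))) τm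
    ... | no  m∉H
        with t , t∈ , τt ← find (All.lookup satD (forcers∈disjunctions m∈M m∉H))
        with C , C∈KB , (_ , ¬stray) , refl ← ∈-forcers⁻ t∈
        -- The variable of `C` true under `σ` must be `m`: any other lies in the residue, which `τ`
        -- and hence `σ` make false.
        with x , x∈C , σx ← find (All.lookup satKB C∈KB)
        with x ≟ m
    ...   | yes refl = σx
    ...   | no  x≢m = contradiction
      (trans (sat-literal⁻ τ (All.lookup satE (∈-map⁺ (literal τ) (¬stray⇒∈H ¬stray x∈C (∉[m] x≢m)))))
        (All.lookup τt (∈-residue⁺ x∈C (∉[m] x≢m))))
      (true≢false σx)

theorem21 : ∀ (k : ℕ) → 1 ≤ k →
    Σ[ r ∈ ABD-CNF⁺ k ≤CV SimpleSAT k ]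
    (∀ (I : AbdInstance k) → simpleVars (_≤CV_.reduce r I) ⊆ AbdInstance.H I)
theorem21 k 1≤k = record
  { reduce        = reduce 1≤k
  ; isCVReduction = record
    { polyTime = reduce-polyTime 1≤k
    ; correct  = λ I → mk⇔ (explanation⇒model 1≤k I) (model⇒explanation 1≤k I)
    ; varBound = 0 , λ I → ≤-trans (card-bound 1≤k I) (m≤m+n _ 0)
    }
  } , simpleVars⊆H 1≤k
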